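{- Let $G$ be a graph and $u\in V(G)$. Let $H$ be the graph obtained from $G$ by attaching a false twin $u'$ to $u$, i.e. by adding a new vertex $u'$ whose neighbors are exactly the vertices of $N_G(u)$. Then $\gamma_I(H)=\gamma_I(G)$ or $\gamma_I(H)=\gamma_I(G)+1$.
   Context: All graphs are finite, simple and undirected. $N(v)$ denotes the open neighborhood of a vertex $v$. An Italian dominating function (IDF) of a graph $G$ is a function $f:V(G)\to\{0,1,2\}$ such that every $v\in V(G)$ with $f(v)=0$ satisfies $\sum_{u\in N(v)}f(u)\ge 2$. Its weight is $\sum_{v\in V(G)}f(v)$, and the Italian domination number $\gamma_I(G)$ is the minimum weight of an IDF of $G$. -}

module Defs where

open import Data.Empty using (⊥)
open import Data.Fin using (Fin; zero; suc; toℕ; finToFun; funToFin)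
open import Data.Fin.Patterns using (0F; 2F)
open import Data.Fin.Properties using (all?; finToFun-funToFin) renaming (_≟_ to _≟ᶠ_)
open import Data.List using (List; map; filter; allFin; sum)
open import Data.List.Extrema.Nat using (argmin; argmin-all; f[argmin]≤v⁺)
open import Data.List.Membership.Propositional using (lose)
open import Data.List.Membership.Propositional.Properties using (∈-map⁺; ∈-filter⁺; ∈-allFin)
open import Data.List.Properties using (map-cong)
open import Data.List.Relation.Unary.All.Properties using (all-filter)
open import Data.Nat using (ℕ; suc; _^_; _≤_; _≤?_)
open import Data.Nat.Properties using (≤-reflexive)
open import Data.Product using (∃; _×_; _,_)
open import Data.Sum using (inj₂)
open import Function using (_∘_; const)
open import Relation.Binary using (Decidable; Symmetric; Irreflexive)
open import Relation.Binary.PropositionalEquality using (_≡_; _≗_; refl; sym; trans; cong; subst)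
open import Relation.Nullary using (Dec; no; _→-dec_)

record Graph (n : ℕ) : Set₁ where
  field
    Adj    : Fin n → Fin n → Set
    adj?   : Decidable Adj
    symm   : Symmetric Adj
    irrefl : Irreflexive _≡_ Adj

  N : Fin n → List (Fin n)
  N v = filter (adj? v) (allFin n)

open Graph public using (N)

Labelling : ℕ → Set
Labelling n = Fin n → Fin 3

sumOver : ∀ {n} → Labelling n → List (Fin n) → ℕ
sumOver f vs = sum (map (toℕ ∘ f) vs)

weight : ∀ {n} → Labelling n → ℕ
weight {n} f = sumOver f (allFin n)

IsIDF : ∀ {n} → Graph n → Labelling n → Set
IsIDF G f = ∀ v → f v ≡ 0F → 2 ≤ sumOver f (N G v)

isIDF? : ∀ {n} (G : Graph n) (f : Labelling n) → Dec (IsIDF G f)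
isIDF? G f = all? λ v → (f v ≟ᶠ 0F) →-dec (2 ≤? sumOver f (N G v))

allLabellings : ∀ n → List (Labelling n)
allLabellings n = map finToFun (allFin (3 ^ n))

-- The starting value const 2F of argmin is itself an IDF, so it does not
-- affect the minimum; see γI-attained and γI-minimal.
γI : ∀ {n} → Graph n → ℕ
γI {n} G = weight (argmin weight (const 2F) (filter (isIDF? G) (allLabellings n)))

γI-attained : ∀ {n} (G : Graph n) → ∃ λ f → IsIDF G f × weight f ≡ γI G
γI-attained {n} G =
  _ , argmin-all weight (λ _ ()) (all-filter (isIDF? G) (allLabellings n)) , refl

sumOver-cong : ∀ {n} {f g : Labelling n} → f ≗ g → ∀ vs → sumOver f vs ≡ sumOver g vs
sumOver-cong f≗g vs = cong sum (map-cong (cong toℕ ∘ f≗g) vs)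

IsIDF-resp-≗ : ∀ {n} (G : Graph n) {f g : Labelling n} → f ≗ g → IsIDF G f → IsIDF G g
IsIDF-resp-≗ G f≗g idf v gv≡0 =
  subst (2 ≤_) (sumOver-cong f≗g (N G v)) (idf v (trans (f≗g v) gv≡0))

γI-minimal : ∀ {n} (G : Graph n) (f : Labelling n) → IsIDF G f → γI G ≤ weight f
γI-minimal {n} G f idf = f[argmin]≤v⁺ {f = weight} (const 2F) (filter (isIDF? G) (allLabellings n))
  (inj₂ (lose
    (∈-filter⁺ (isIDF? G) (∈-map⁺ finToFun (∈-allFin (funToFin f)))
      (IsIDF-resp-≗ G (sym ∘ finToFun-funToFin f) idf))
    (≤-reflexive (sumOver-cong (finToFun-funToFin f) (allFin n)))))

module _ {n : ℕ} (G : Graph n) (u : Fin n) where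
  open Graph G

  -- The new vertex u' is zero; an old vertex v becomes suc v.
  TwinAdj : Fin (suc n) → Fin (suc n) → Set
  TwinAdj zero    zero    = ⊥
  TwinAdj zero    (suc w) = Adj u w
  TwinAdj (suc v) zero    = Adj v u
  TwinAdj (suc v) (suc w) = Adj v w

  attachFalseTwin : Graph (suc n)
  attachFalseTwin = record
    { Adj    = TwinAdj
    ; adj?   = twinAdj?
    ; symm   = λ {x} {y} → twinSymm x y
    ; irrefl = λ {x} → λ { refl → twinIrrefl x }
    }
    where
    twinAdj? : Decidable TwinAdj
    twinAdj? zero    zero    = no λ ()
    twinAdj? zero    (suc w) = adj? u w
    twinAdj? (suc v) zero    = adj? v u
    twinAdj? (suc v) (suc w) = adj? v w

    twinSymm : ∀ x y → TwinAdj x y → TwinAdj y x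
    twinSymm zero    (suc w) = symm
    twinSymm (suc v) zero    = symm
    twinSymm (suc v) (suc w) = symm

    twinIrrefl : ∀ x → TwinAdj x x → ⊥
    twinIrrefl (suc v) = irrefl refl

{-# OPTIONS --safe #-}
-- Upper bound: extend a labelling of G by giving u' the label 1; this leaves u' unconstrained,
-- and the old vertices see at least as much as before.  Lower bound: add the label of u' to that
-- of u, capping the total at 2.  The cap costs nothing, since a neighbour of u only has to see
-- weight 2.
module Submission where

open import Defs
open import Algebra.Properties.CommutativeSemigroup using (x∙yz≈xz∙y; x∙yz≈yx∙z; xy∙z≈zy∙x)
open import Data.Fin using (Fin; zero; suc; toℕ; fromℕ<) renaming (_≤_ to _≤ᶠ_)
open import Data.Fin.Patterns using (0F; 1F)
open import Data.Fin.Properties using (toℕ-fromℕ<; toℕ-injective; toℕ≤pred[n])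
  renaming (≤-refl to ≤ᶠ-refl)
open import Data.List using (List; []; _∷_; map; filter; allFin; tabulate)
open import Data.List.Membership.Propositional using (_∈_)
open import Data.List.Membership.Propositional.Properties using (∈-filter⁺; ∈-allFin)
open import Data.List.Properties using (map-∘; map-tabulate; filter-accept; filter-reject)
open import Data.List.Relation.Unary.Any using (here; there)
open import Data.Nat using (ℕ; suc; _+_; _⊓_; _≤_; z≤n; s≤s)
open import Data.Nat.ListAction using (sum)
open import Data.Nat.Properties
  using ( ≤-refl; ≤-reflexive; ≤-trans; ≤-antisym; m≤n⇒m<n∨m≡n; n≤0⇒n≡0
        ; +-comm; +-assoc; +-mono-≤; +-monoʳ-≤; +-cancelʳ-≤; +-commutativeSemigroup
        ; m≤m+n; m≤n+m; +-distribʳ-⊓; ⊓-monoˡ-≤; ⊓-glb; m⊓n≤m; m⊓n≤n; module ≤-Reasoning)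
open import Data.Product using (_,_)
open import Data.Sum using (_⊎_; inj₁; inj₂)
open import Data.Vec.Functional using (Vector; updateAt) renaming (_∷_ to _∷ᵛ_)
open import Data.Vec.Functional.Properties using (updateAt-updates)
open import Function using (_∘_; id; case_of_)
open import Level using (Level)
open import Relation.Binary using (Rel; Reflexive)
open import Relation.Binary.PropositionalEquality
  using (_≡_; _≢_; refl; sym; trans; cong; subst; module ≡-Reasoning)
open import Relation.Nullary using (¬_; yes; no; contradiction)
open import Relation.Unary using (Pred; Decidable)

private
  variable
    a b p : Level
    A : Set a
    B : Set b
    m n : ℕ

filter-map : {P : Pred B p} (P? : Decidable P) (f : A → B) (xs : List A) →
             filter P? (map f xs) ≡ map f (filter (P? ∘ f) xs)
filter-map P? f []       = refl
filter-map P? f (x ∷ xs) with P? (f x)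
... | yes _ = cong (f x ∷_) (filter-map P? f xs)
... | no  _ = filter-map P? f xs

filter-tabulate-suc : {P : Pred (Fin (suc n)) p} (P? : Decidable P) →
                      filter P? (tabulate suc) ≡ map suc (filter (P? ∘ suc) (allFin n))
filter-tabulate-suc {n} P? = begin
  filter P? (tabulate suc)                 ≡⟨ cong (filter P?) (map-tabulate id suc) ⟨
  filter P? (map suc (allFin n))           ≡⟨ filter-map P? suc (allFin n) ⟩
  map suc (filter (P? ∘ suc) (allFin n))   ∎
  where open ≡-Reasoning

m⊓[n+o]≤m⊓n+o : ∀ m n o → m ⊓ (n + o) ≤ m ⊓ n + o
m⊓[n+o]≤m⊓n+o m n o = begin
  m ⊓ (n + o)         ≤⟨ ⊓-monoˡ-≤ (n + o) (m≤m+n m o) ⟩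
  (m + o) ⊓ (n + o)   ≡⟨ +-distribʳ-⊓ o m n ⟨
  m ⊓ n + o           ∎
  where open ≤-Reasoning

sum-map-mono-≤ : {f g : A → ℕ} → (∀ x → f x ≤ g x) → ∀ xs → sum (map f xs) ≤ sum (map g xs)
sum-map-mono-≤ f≤g []       = z≤n
sum-map-mono-≤ f≤g (x ∷ xs) = +-mono-≤ (f≤g x) (sum-map-mono-≤ f≤g xs)

sum-map-gain-⊓ : {f g : A → ℕ} (k c : ℕ) {x : A} → (∀ y → f y ≤ g y) →
                 k ⊓ (c + f x) ≤ g x → ∀ {xs} → x ∈ xs →
                 k ⊓ (c + sum (map f xs)) ≤ sum (map g xs)
sum-map-gain-⊓ {f = f} {g} k c {x} f≤g gain {_ ∷ xs} (here refl) = begin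
  k ⊓ (c + (f x + sum (map f xs)))   ≡⟨ cong (k ⊓_) (+-assoc c (f x) _) ⟨
  k ⊓ (c + f x + sum (map f xs))     ≤⟨ m⊓[n+o]≤m⊓n+o k (c + f x) _ ⟩
  k ⊓ (c + f x) + sum (map f xs)     ≤⟨ +-mono-≤ gain (sum-map-mono-≤ f≤g xs) ⟩
  g x + sum (map g xs)               ∎
  where open ≤-Reasoning
sum-map-gain-⊓ {f = f} {g} k c f≤g gain {y ∷ xs} (there x∈xs) = begin
  k ⊓ (c + (f y + sum (map f xs)))   ≡⟨ cong (k ⊓_) (x∙yz≈xz∙y +-commutativeSemigroup c (f y) _) ⟩
  k ⊓ (c + sum (map f xs) + f y)     ≤⟨ m⊓[n+o]≤m⊓n+o k _ (f y) ⟩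
  k ⊓ (c + sum (map f xs)) + f y     ≤⟨ +-mono-≤ (sum-map-gain-⊓ k c f≤g gain x∈xs) (f≤g y) ⟩
  sum (map g xs) + g y               ≡⟨ +-comm _ (g y) ⟩
  g y + sum (map g xs)               ∎
  where open ≤-Reasoning

updateAt-inflationary : {_≼_ : Rel A p} → Reflexive _≼_ → {φ : A → A} → (∀ x → x ≼ φ x) →
                        (xs : Vector A n) → ∀ i j → xs j ≼ updateAt xs i φ j
updateAt-inflationary ≼-refl ≼φ xs zero    zero    = ≼φ (xs zero)
updateAt-inflationary ≼-refl ≼φ xs zero    (suc j) = ≼-refl
updateAt-inflationary ≼-refl ≼φ xs (suc i) zero    = ≼-refl
updateAt-inflationary {_≼_ = _≼_} ≼-refl ≼φ xs (suc i) (suc j) =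
  updateAt-inflationary {_≼_ = _≼_} ≼-refl ≼φ (xs ∘ suc) i j

infixl 6 _⊕_

_⊕_ : Fin (suc n) → Fin (suc n) → Fin (suc n)
_⊕_ {n} i j = fromℕ< (s≤s (m⊓n≤m n (toℕ i + toℕ j)))

toℕ-⊕ : (i j : Fin (suc n)) → toℕ (i ⊕ j) ≡ n ⊓ (toℕ i + toℕ j)
toℕ-⊕ i j = toℕ-fromℕ< _

i⊕j≤i+j : (i j : Fin (suc n)) → toℕ (i ⊕ j) ≤ toℕ i + toℕ j
i⊕j≤i+j {n} i j = ≤-trans (≤-reflexive (toℕ-⊕ i j)) (m⊓n≤n n _)

j≤i⊕j : (i j : Fin (suc n)) → j ≤ᶠ i ⊕ j
j≤i⊕j i j = ≤-trans (⊓-glb (toℕ≤pred[n] j) (m≤n+m _ (toℕ i))) (≤-reflexive (sym (toℕ-⊕ i j)))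

sumOver-map : (g : Labelling n) (φ : Fin m → Fin n) (vs : List (Fin m)) →
              sumOver g (map φ vs) ≡ sumOver (g ∘ φ) vs
sumOver-map g φ vs = cong sum (sym (map-∘ vs))

weight-suc : (g : Labelling (suc n)) → weight g ≡ toℕ (g zero) + weight (g ∘ suc)
weight-suc {n} g = cong (toℕ (g zero) +_) (begin
  sumOver g (tabulate suc)         ≡⟨ cong (sumOver g) (map-tabulate id suc) ⟨
  sumOver g (map suc (allFin n))   ≡⟨ sumOver-map g suc (allFin n) ⟩
  weight (g ∘ suc)                 ∎)
  where open ≡-Reasoning

weight-updateAt : (f : Labelling n) (u : Fin n) (φ : Fin 3 → Fin 3) →
                  weight (updateAt f u φ) + toℕ (f u) ≡ weight f + toℕ (φ (f u))
weight-updateAt f zero φ = begin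
  weight (updateAt f zero φ) + toℕ (f zero)
    ≡⟨ cong (_+ toℕ (f zero)) (weight-suc (updateAt f zero φ)) ⟩
  toℕ (φ (f zero)) + weight (f ∘ suc) + toℕ (f zero)
    ≡⟨ xy∙z≈zy∙x +-commutativeSemigroup (toℕ (φ (f zero))) _ _ ⟩
  toℕ (f zero) + weight (f ∘ suc) + toℕ (φ (f zero))
    ≡⟨ cong (_+ toℕ (φ (f zero))) (weight-suc f) ⟨
  weight f + toℕ (φ (f zero)) ∎
  where open ≡-Reasoning
weight-updateAt f (suc u) φ = begin
  weight (updateAt f (suc u) φ) + toℕ (f (suc u))
    ≡⟨ cong (_+ toℕ (f (suc u))) (weight-suc (updateAt f (suc u) φ)) ⟩
  toℕ (f zero) + weight (updateAt (f ∘ suc) u φ) + toℕ (f (suc u))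
    ≡⟨ +-assoc (toℕ (f zero)) _ _ ⟩
  toℕ (f zero) + (weight (updateAt (f ∘ suc) u φ) + toℕ (f (suc u)))
    ≡⟨ cong (toℕ (f zero) +_) (weight-updateAt (f ∘ suc) u φ) ⟩
  toℕ (f zero) + (weight (f ∘ suc) + toℕ (φ (f (suc u))))
    ≡⟨ +-assoc (toℕ (f zero)) _ _ ⟨
  toℕ (f zero) + weight (f ∘ suc) + toℕ (φ (f (suc u)))
    ≡⟨ cong (_+ toℕ (φ (f (suc u)))) (weight-suc f) ⟨
  weight f + toℕ (φ (f (suc u))) ∎
  where open ≡-Reasoning

module _ (G : Graph n) (u : Fin n) where
  open Graph G using (Adj; adj?)

  private
    H : Graph (suc n)
    H = attachFalseTwin G u

  open Graph H using () renaming (adj? to adjᴴ?)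

  N-twin-adj : ∀ {v} → Adj v u → N H (suc v) ≡ zero ∷ map suc (N G v)
  N-twin-adj {v} v~u = begin
    filter (adjᴴ? (suc v)) (zero ∷ tabulate suc)
      ≡⟨ filter-accept (adjᴴ? (suc v)) {zero} {tabulate suc} v~u ⟩
    zero ∷ filter (adjᴴ? (suc v)) (tabulate suc)
      ≡⟨ cong (zero ∷_) (filter-tabulate-suc (adjᴴ? (suc v))) ⟩
    zero ∷ map suc (N G v) ∎
    where open ≡-Reasoning

  N-twin-nonadj : ∀ {v} → ¬ Adj v u → N H (suc v) ≡ map suc (N G v)
  N-twin-nonadj {v} v≁u = begin
    filter (adjᴴ? (suc v)) (zero ∷ tabulate suc)
      ≡⟨ filter-reject (adjᴴ? (suc v)) {zero} {tabulate suc} v≁u ⟩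
    filter (adjᴴ? (suc v)) (tabulate suc)
      ≡⟨ filter-tabulate-suc (adjᴴ? (suc v)) ⟩
    map suc (N G v) ∎
    where open ≡-Reasoning

  sumOver-N-twin-adj : (g : Labelling (suc n)) → ∀ {v} → Adj v u →
                       sumOver g (N H (suc v)) ≡ toℕ (g zero) + sumOver (g ∘ suc) (N G v)
  sumOver-N-twin-adj g {v} v~u = trans (cong (sumOver g) (N-twin-adj v~u))
                                       (cong (toℕ (g zero) +_) (sumOver-map g suc (N G v)))

  sumOver-N-twin-nonadj : (g : Labelling (suc n)) → ∀ {v} → ¬ Adj v u →
                          sumOver g (N H (suc v)) ≡ sumOver (g ∘ suc) (N G v)
  sumOver-N-twin-nonadj g {v} v≁u = trans (cong (sumOver g) (N-twin-nonadj v≁u))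
                                          (sumOver-map g suc (N G v))

  sumOver-N≤sumOver-N-twin : (g : Labelling (suc n)) (v : Fin n) →
                             sumOver (g ∘ suc) (N G v) ≤ sumOver g (N H (suc v))
  sumOver-N≤sumOver-N-twin g v = case adj? v u of λ where
    (yes v~u) → ≤-trans (m≤n+m _ (toℕ (g zero))) (≤-reflexive (sym (sumOver-N-twin-adj g v~u)))
    (no  v≁u) → ≤-reflexive (sym (sumOver-N-twin-nonadj g v≁u))

  extend-IsIDF : {f : Labelling n} {i : Fin 3} → i ≢ 0F → IsIDF G f → IsIDF H (i ∷ᵛ f)
  extend-IsIDF         i≢0 idf zero    i≡0  = contradiction i≡0 i≢0
  extend-IsIDF {f} {i} i≢0 idf (suc v) fv≡0 =
    ≤-trans (idf v fv≡0) (sumOver-N≤sumOver-N-twin (i ∷ᵛ f) v)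

  mergeTwin : Labelling (suc n) → Labelling n
  mergeTwin g = updateAt (g ∘ suc) u (g zero ⊕_)

  ≤-mergeTwin : (g : Labelling (suc n)) (v : Fin n) → g (suc v) ≤ᶠ mergeTwin g v
  ≤-mergeTwin g = updateAt-inflationary {_≼_ = _≤ᶠ_} ≤ᶠ-refl (j≤i⊕j (g zero)) (g ∘ suc) u

  mergeTwin≡0⇒≡0 : (g : Labelling (suc n)) (v : Fin n) → mergeTwin g v ≡ 0F → g (suc v) ≡ 0F
  mergeTwin≡0⇒≡0 g v mv≡0 =
    toℕ-injective (n≤0⇒n≡0 (subst (g (suc v) ≤ᶠ_) mv≡0 (≤-mergeTwin g v)))

  toℕ-mergeTwin-u : (g : Labelling (suc n)) →
                    toℕ (mergeTwin g u) ≡ 2 ⊓ (toℕ (g zero) + toℕ (g (suc u)))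
  toℕ-mergeTwin-u g = trans (cong toℕ (updateAt-updates u (g ∘ suc))) (toℕ-⊕ (g zero) (g (suc u)))

  2⊓sumOver-N-twin≤sumOver-mergeTwin :
    (g : Labelling (suc n)) → ∀ {v} → Adj v u →
    2 ⊓ sumOver g (N H (suc v)) ≤ sumOver (mergeTwin g) (N G v)
  2⊓sumOver-N-twin≤sumOver-mergeTwin g {v} v~u = begin
    2 ⊓ sumOver g (N H (suc v))
      ≡⟨ cong (2 ⊓_) (sumOver-N-twin-adj g v~u) ⟩
    2 ⊓ (toℕ (g zero) + sumOver (g ∘ suc) (N G v))
      ≤⟨ sum-map-gain-⊓ 2 (toℕ (g zero)) (≤-mergeTwin g) (≤-reflexive (sym (toℕ-mergeTwin-u g))) u∈Nv ⟩
    sumOver (mergeTwin g) (N G v) ∎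
    where
    open ≤-Reasoning
    u∈Nv : u ∈ N G v
    u∈Nv = ∈-filter⁺ (adj? v) (∈-allFin u) v~u

  mergeTwin-IsIDF : {g : Labelling (suc n)} → IsIDF H g → IsIDF G (mergeTwin g)
  mergeTwin-IsIDF {g} idf v mv≡0 with adj? v u
  ... | yes v~u = ≤-trans (⊓-glb ≤-refl (idf (suc v) (mergeTwin≡0⇒≡0 g v mv≡0)))
                          (2⊓sumOver-N-twin≤sumOver-mergeTwin g v~u)
  ... | no  v≁u = begin
    2                               ≤⟨ idf (suc v) (mergeTwin≡0⇒≡0 g v mv≡0) ⟩
    sumOver g (N H (suc v))         ≡⟨ sumOver-N-twin-nonadj g v≁u ⟩
    sumOver (g ∘ suc) (N G v)       ≤⟨ sum-map-mono-≤ (≤-mergeTwin g) (N G v) ⟩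
    sumOver (mergeTwin g) (N G v)   ∎
    where open ≤-Reasoning

  weight-mergeTwin≤weight : (g : Labelling (suc n)) → weight (mergeTwin g) ≤ weight g
  weight-mergeTwin≤weight g = +-cancelʳ-≤ (toℕ (g (suc u))) _ _ (begin
    weight (mergeTwin g) + toℕ (g (suc u))
      ≡⟨ weight-updateAt (g ∘ suc) u (g zero ⊕_) ⟩
    weight (g ∘ suc) + toℕ (g zero ⊕ g (suc u))
      ≤⟨ +-monoʳ-≤ (weight (g ∘ suc)) (i⊕j≤i+j (g zero) (g (suc u))) ⟩
    weight (g ∘ suc) + (toℕ (g zero) + toℕ (g (suc u)))
      ≡⟨ x∙yz≈yx∙z +-commutativeSemigroup (weight (g ∘ suc)) (toℕ (g zero)) _ ⟩
    toℕ (g zero) + weight (g ∘ suc) + toℕ (g (suc u))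
      ≡⟨ cong (_+ toℕ (g (suc u))) (weight-suc g) ⟨
    weight g + toℕ (g (suc u)) ∎)
    where open ≤-Reasoning

  γI≤γI-twin : γI G ≤ γI H
  γI≤γI-twin with g , idf , wg≡γ ← γI-attained H = begin
    γI G                   ≤⟨ γI-minimal G (mergeTwin g) (mergeTwin-IsIDF idf) ⟩
    weight (mergeTwin g)   ≤⟨ weight-mergeTwin≤weight g ⟩
    weight g               ≡⟨ wg≡γ ⟩
    γI H                   ∎
    where open ≤-Reasoning

  γI-twin≤1+γI : γI H ≤ suc (γI G)
  γI-twin≤1+γI with f , idf , wf≡γ ← γI-attained G = begin
    γI H              ≤⟨ γI-minimal H (1F ∷ᵛ f) (extend-IsIDF (λ ()) idf) ⟩
    weight (1F ∷ᵛ f)  ≡⟨ weight-suc (1F ∷ᵛ f) ⟩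
    suc (weight f)    ≡⟨ cong suc wf≡γ ⟩
    suc (γI G)        ∎
    where open ≤-Reasoning

theorem3p4 : ∀ (n : ℕ) (G : Graph n) (u : Fin n) → (γI (attachFalseTwin G u) ≡ γI G) ⊎ (γI (attachFalseTwin G u) ≡ γI G + 1)
theorem3p4 n G u with m≤n⇒m<n∨m≡n (γI≤γI-twin G u)
... | inj₁ γG<γH = inj₂ (trans (≤-antisym (γI-twin≤1+γI G u) γG<γH) (+-comm 1 (γI G)))
... | inj₂ γG≡γH = inj₁ (sym γG≡γH)
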